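{- Let $k\ge 2$, suppose $n\ge 2k^2$, and let $V$ be a set with $|V|=2n$. Then there is a sequence of colorings $\chi_0,\dots,\chi_\ell\colon V^k\to C$ of length $\ell\ge(\frac{n}{2k})^{k-1}$ such that (I) $\chi_t$ is shufflable and compatible with equality for all $t\in\{0,\dots,\ell\}$, (II) $\chi_t$ is $k$-stable for all $t\in\{0,\dots,\ell\}$, and (III) $\chi_t\prec\chi_{t-1}$ for all $t\in\{1,\dots,\ell\}$.
   Context: For colorings $\chi_1,\chi_2\colon V^k\to C$: $\chi_1\preceq\chi_2$ if $\chi_1(\vec v)=\chi_1(\vec w)$ implies $\chi_2(\vec v)=\chi_2(\vec w)$; $\chi_1\equiv\chi_2$ if both directions hold; $\chi_1\prec\chi_2$ if $\chi_1\preceq\chi_2$ and $\chi_1\not\equiv\chi_2$. The $k$-WL refinement is $\chi'(\vec v)=\big(\chi(\vec v),\{\!\{(\chi(\vec v[w/1]),\dots,\chi(\vec v[w/k]))\mid w\in V\}\!\}\big)$ with $\vec v[w/i]$ the tuple with $i$-th entry replaced by $w$; $\chi$ is $k$-stable if $\chi'\equiv\chi$. A coloring is compatible with equality if tuples $(v_i)$, $(w_i)$ of equal color satisfy $v_i=v_j\iff w_i=w_j$ for all $i,j$. It is shufflable if for every function $\pi\colon[k]\to[k]$, equal color of $(v_1,\dots,v_k)$ and $(w_1,\dots,w_k)$ implies equal color of $(v_{\pi(1)},\dots,v_{\pi(k)})$ and $(w_{\pi(1)},\dots,w_{\pi(k)})$. -}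

module Defs where

open import Data.Nat using (ℕ)
open import Data.Fin using (Fin)
open import Data.List using (List)
open import Data.Vec using (Vec; lookup; tabulate; _[_]≔_)
open import Data.List.Relation.Binary.Permutation.Propositional using (_↭_)
open import Data.Product using (_×_)
open import Relation.Nullary using (¬_)
open import Relation.Binary.PropositionalEquality using (_≡_)
import Data.List.Base as L

allV : (m : ℕ) → List (Fin m)
allV m = L.allFin m

Coloring : (m k : ℕ) → Set → Set
Coloring m k C = Vec (Fin m) k → C

module _ {m k : ℕ} {C : Set} where

  _⪯_ : Coloring m k C → Coloring m k C → Set
  χ₁ ⪯ χ₂ = ∀ v w → χ₁ v ≡ χ₁ w → χ₂ v ≡ χ₂ w

  _≡ᶜ_ : Coloring m k C → Coloring m k C → Set
  χ₁ ≡ᶜ χ₂ = (χ₁ ⪯ χ₂) × (χ₂ ⪯ χ₁)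

  _≺_ : Coloring m k C → Coloring m k C → Set
  χ₁ ≺ χ₂ = (χ₁ ⪯ χ₂) × ¬ (χ₁ ≡ᶜ χ₂)

  -- the multiset {{ (χ(v[u/1]),…,χ(v[u/k])) | u ∈ V }}, as a list up to permutation
  nbrColors : Coloring m k C → Vec (Fin m) k → List (Vec C k)
  nbrColors χ v = L.map (λ u → tabulate (λ i → χ (v [ i ]≔ u))) (allV m)

  -- equality of refined colors χ'(v) = χ'(w); multiset equality is _↭_
  SameRefined : Coloring m k C → Vec (Fin m) k → Vec (Fin m) k → Set
  SameRefined χ v w = (χ v ≡ χ w) × (nbrColors χ v ↭ nbrColors χ w)

  -- χ is k-stable: χ' ≡ χ (written out in terms of equality of colors)
  Stable : Coloring m k C → Set
  Stable χ = ∀ v w → (χ v ≡ χ w → SameRefined χ v w) × (SameRefined χ v w → χ v ≡ χ w)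

  CompatibleEq : Coloring m k C → Set
  CompatibleEq χ = ∀ v w → χ v ≡ χ w → ∀ i j →
    ((lookup v i ≡ lookup v j → lookup w i ≡ lookup w j) ×
     (lookup w i ≡ lookup w j → lookup v i ≡ lookup v j))

  Shufflable : Coloring m k C → Set
  Shufflable χ = ∀ (π : Fin k → Fin k) v w → χ v ≡ χ w →
    χ (tabulate (λ i → lookup v (π i))) ≡ χ (tabulate (λ i → lookup w (π i)))

{-# OPTIONS --safe #-}
-- Write V = [n] × {0,1}, and let a block system be a family of k-subsets of [n] any
-- two of which differ in at least two elements.  Colour a tuple over V by its orbit
-- under flipping the second coordinates of whole fibres, where the fibres over a block
-- may only be flipped an even number of times.  When a point b is added to a k-tuple,
-- at most one of the k new supports is a block, so a local flip of the tuple extends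
-- to b with no conflict: this gives stability.  Every subfamily of a block system is a
-- block system, so adding the blocks one at a time gives a chain of stable colourings
-- whose length is the number of blocks.  With m = ⌊n/k⌋, the graph of the
-- check digit d₁ + … + d_{k-1} mod m is a block system with m^(k-1) members.
module Submission where

open import Defs
open import Algebra.Bundles using (CommutativeRing)
open import Data.Bool.Base using (Bool; true; false; _xor_; if_then_else_)
open import Data.Bool.Properties using (xor-∧-commutativeRing; xor-assoc; xor-comm; xor-same)
open import Data.Fin using (Fin; inject₁; toℕ; zero; combine; remQuot; punchIn; punchOut; finToFun; funToFin; inject≤) renaming (suc to fsuc)
open import Data.Fin.Permutation using (Permutation′; permutation; _⟨$⟩ʳ_)
open import Data.Fin.Properties using (_≟_; any?; all?; punchOut-injective; <⇒notInjective; 2↔Bool; remQuot-combine; combine-remQuot; combine-injective; funToFin-finToFin; toℕ<n; toℕ-inject₁; toℕ-injective; toℕ-fromℕ<; inject≤-injective; punchInᵢ≢i)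
import Data.List.Base as L
open import Data.List.Membership.Propositional using (_∈_)
open import Data.List.Membership.Propositional.Properties using (∈-allFin; ∈-map⁺)
open import Data.List.Membership.Propositional.Properties.WithK using (unique∧set⇒bag)
import Data.List.Properties as L
open import Data.List.Relation.Binary.BagAndSetEquality using (∼bag⇒↭)
open import Data.List.Relation.Binary.Permutation.Propositional using (_↭_)
open import Data.List.Relation.Binary.Permutation.Propositional.Properties using () renaming (map⁺ to ↭-map⁺)
open import Data.List.Relation.Unary.Unique.Propositional.Properties using (allFin⁺) renaming (map⁺ to Unique-map⁺)
open import Data.Nat using (ℕ; suc; _+_; _*_; _∸_; _^_; _≤_; _<_; NonZero; >-nonZero)
open import Data.Nat.DivMod using (_/_; _%_; _mod_; m%n<n; m<n⇒m%n≡m; %-distribˡ-+; [m+kn]%n≡m%n; m≡m%n+[m/n]*n; m/n*n≤m; m≥n⇒m/n>0)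
open import Data.Nat.Properties using (_<?_; +-0-commutativeMonoid; +-assoc; +-identityʳ; *-suc; *-comm; *-identityˡ; *-distribˡ-+; +-monoˡ-≤; *-monoˡ-≤; ^-monoˡ-≤; [m*n]*[o*p]≡[m*o]*[n*p]; m≤m*n; m≤n*m; ≤-refl; ≤-trans; ≤-reflexive; <-irrefl; <⇒≤; n<1+n; module ≤-Reasoning)
open import Data.Product using (Σ; ∃; _×_; _,_; proj₁; proj₂)
open import Data.Product.Properties using (,-injective)
open import Data.Vec using (Vec; []; _∷_; lookup; tabulate; map; _[_]≔_)
open import Data.Vec.Properties using (lookup∘update; lookup∘update′; []≔-lookup; lookup-map; map-[]≔; map-∘; map-cong; map-id; lookup∘tabulate; tabulate-∘; tabulate-cong)
open import Function.Base using (_∘_)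
open import Function.Bundles using (mk⇔; module Inverse)
open import Function.Definitions using (Injective)
open import Relation.Binary.PropositionalEquality
open import Relation.Nullary using (¬_; Dec; yes; no; does; contradiction; _×-dec_)
open import Relation.Nullary.Decidable using (map′; dec-true; dec-false; decidable-stable)

open import Algebra.Properties.CommutativeMonoid.Sum (CommutativeRing.+-commutativeMonoid xor-∧-commutativeRing) using (∑-distrib-+; sum-permute; sum-cong-≗; sum-replicate-zero) renaming (sum to xorSum)
open import Algebra.Properties.CommutativeMonoid.Sum +-0-commutativeMonoid using () renaming (sum to ∑; sum-remove to ∑-remove; sum-cong-≗ to ∑-cong)

-- Finite maps, reindexing and the multiset of all vertices

injective⇒surjective : ∀ {k} {f : Fin k → Fin k} → Injective _≡_ _≡_ f → ∀ y → ∃ λ x → f x ≡ y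
injective⇒surjective {suc k} {f} inj y = decidable-stable (any? λ x → f x ≟ y) λ miss →
  let y≢f = λ x eq → miss (x , sym eq) in
  <⇒notInjective {f = λ x → punchOut (y≢f x)} (n<1+n k)
    λ {x} {x′} eq → inj (punchOut-injective (y≢f x) (y≢f x′) eq)

injective⇒permutation : ∀ {k} {f : Fin k → Fin k} → Injective _≡_ _≡_ f →
  ∃ λ (π : Permutation′ k) → ∀ i → π ⟨$⟩ʳ i ≡ f i
injective⇒permutation {f = f} inj =
  permutation f (proj₁ ∘ surj) (proj₂ ∘ surj) (λ x → inj (proj₂ (surj (f x)))) , λ _ → refl
  where surj = injective⇒surjective inj

-- Both lists are free of repetitions and contain all of `Fin m`, so they agree as multisets.
map-involution-↭ : ∀ {m} (f : Fin m → Fin m) → (∀ x → f (f x) ≡ x) → L.map f (allV m) ↭ allV m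
map-involution-↭ {m} f inv = ∼bag⇒↭ (unique∧set⇒bag
  (Unique-map⁺ (λ {x} {y} eq → trans (sym (inv x)) (trans (cong f eq) (inv y))) (allFin⁺ m))
  (allFin⁺ m)
  (λ {x} → mk⇔ (λ _ → ∈-allFin x) (λ _ → subst (_∈ L.map f (allV m)) (inv x) (∈-map⁺ f (∈-allFin (f x))))))

map-reindex : ∀ {A B : Set} {k l} (f : A → B) (v : Vec A k) (π : Fin l → Fin k) →
  map f (tabulate (lookup v ∘ π)) ≡ tabulate (lookup (map f v) ∘ π)
map-reindex f v π = trans (sym (tabulate-∘ f (lookup v ∘ π)))
  (tabulate-cong λ i → sym (lookup-map (π i) f v))

funToFin-cong : ∀ {q m} {f g : Fin q → Fin m} → f ≗ g → funToFin f ≡ funToFin g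
funToFin-cong {0}     eq = refl
funToFin-cong {suc q} eq = cong₂ combine (eq zero) (funToFin-cong (eq ∘ fsuc))

finToFun-injective : ∀ {q m} {r s : Fin (m ^ q)} → finToFun {m} {q} r ≗ finToFun s → r ≡ s
finToFun-injective {q} {m} {r} {s} eq = begin
  r                            ≡⟨ funToFin-finToFin {q} {m} r ⟨
  funToFin (finToFun {m} {q} r) ≡⟨ funToFin-cong eq ⟩
  funToFin (finToFun {m} {q} s) ≡⟨ funToFin-finToFin {q} {m} s ⟩
  s                            ∎
  where open ≡-Reasoning

-- Parity along a tuple, in the field with two elements

xor-cancelˡ : ∀ x y → x xor (x xor y) ≡ y
xor-cancelˡ x y = trans (sym (xor-assoc x x y)) (cong (_xor y) (xor-same x))

abstract

  parity : ∀ {n k} → (Fin n → Bool) → Vec (Fin n) k → Bool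
  parity g a = xorSum (λ i → g (lookup a i))

  parity-cong : ∀ {n k} {g h : Fin n → Bool} (a : Vec (Fin n) k) →
    (∀ i → g (lookup a i) ≡ h (lookup a i)) → parity g a ≡ parity h a
  parity-cong a = sum-cong-≗

  parity-xor : ∀ {n k} (g h : Fin n → Bool) (a : Vec (Fin n) k) →
    parity (λ b → g b xor h b) a ≡ parity g a xor parity h a
  parity-xor g h a = ∑-distrib-+ (g ∘ lookup a) (h ∘ lookup a)

  -- In characteristic two the old term is removed by adding it once more.
  parity-update : ∀ {n k} (g : Fin n → Bool) (a : Vec (Fin n) k) i b →
    parity g (a [ i ]≔ b) ≡ (parity g a xor g (lookup a i)) xor g b
  parity-update g (c ∷ a) zero b = begin
    g b xor parity g a                         ≡⟨ xor-comm (g b) _ ⟩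
    parity g a xor g b                         ≡⟨ cong (_xor g b) (xor-cancelˡ (g c) _) ⟨
    (g c xor (g c xor parity g a)) xor g b     ≡⟨ cong (_xor g b) (xor-comm (g c) _) ⟩
    ((g c xor parity g a) xor g c) xor g b     ∎
    where open ≡-Reasoning
  parity-update g (c ∷ a) (fsuc i) b = begin
    g c xor parity g (a [ i ]≔ b)
      ≡⟨ cong (g c xor_) (parity-update g a i b) ⟩
    g c xor ((parity g a xor g (lookup a i)) xor g b)
      ≡⟨ xor-assoc (g c) _ (g b) ⟨
    (g c xor (parity g a xor g (lookup a i))) xor g b
      ≡⟨ cong (_xor g b) (xor-assoc (g c) _ _) ⟨
    ((g c xor parity g a) xor g (lookup a i)) xor g b ∎
    where open ≡-Reasoning

  parity-permute : ∀ {n k} (g : Fin n → Bool) (a : Vec (Fin n) k) {π : Fin k → Fin k} →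
    Injective _≡_ _≡_ π → parity g (tabulate (lookup a ∘ π)) ≡ parity g a
  parity-permute g a {π} inj with ρ , ρ≗π ← injective⇒permutation inj = begin
    parity g (tabulate (lookup a ∘ π))
      ≡⟨ sum-cong-≗ (λ i → cong g (trans (lookup∘tabulate _ i) (cong (lookup a) (sym (ρ≗π i))))) ⟩
    xorSum (λ i → g (lookup a (ρ ⟨$⟩ʳ i)))
      ≡⟨ sum-permute (g ∘ lookup a) ρ ⟨
    parity g a ∎
    where open ≡-Reasoning

  parity-indicator : ∀ {n p} (a : Vec (Fin n) (suc p)) → Injective _≡_ _≡_ (lookup a) →
    parity (λ b → does (b ≟ lookup a zero)) a ≡ true
  parity-indicator {p = p} (c ∷ a) inj = cong₂ _xor_ (dec-true (c ≟ c) refl)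
    (trans (sum-cong-≗ (λ i → dec-false (lookup a i ≟ c) λ eq → contradiction (inj {fsuc i} {zero} eq) λ ()))
           (sum-replicate-zero p))

-- Flipping fibres of V = {0,1} × [n]

module Fibres (n : ℕ) where

  abstract

    base : Fin (2 * n) → Fin n
    base u = proj₂ (remQuot {2} n u)

    bit : Fin (2 * n) → Bool
    bit u = Inverse.to 2↔Bool (proj₁ (remQuot {2} n u))

    vertex : Bool → Fin n → Fin (2 * n)
    vertex x b = combine (Inverse.from 2↔Bool x) b

    base-vertex : ∀ x b → base (vertex x b) ≡ b
    base-vertex x b = cong proj₂ (remQuot-combine (Inverse.from 2↔Bool x) b)

    bit-vertex : ∀ x b → bit (vertex x b) ≡ x
    bit-vertex x b = trans (cong (Inverse.to 2↔Bool ∘ proj₁) (remQuot-combine (Inverse.from 2↔Bool x) b))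
                           (Inverse.strictlyInverseˡ 2↔Bool x)

    vertex-bit-base : ∀ u → vertex (bit u) (base u) ≡ u
    vertex-bit-base u = trans (cong (λ x → combine x (base u)) (Inverse.strictlyInverseʳ 2↔Bool (proj₁ (remQuot {2} n u))))
                              (combine-remQuot {2} n u)

  flip : (Fin n → Bool) → Fin (2 * n) → Fin (2 * n)
  flip g u = vertex (g (base u) xor bit u) (base u)

  base-flip : ∀ g u → base (flip g u) ≡ base u
  base-flip g u = base-vertex _ _

  bit-flip : ∀ g u → bit (flip g u) ≡ g (base u) xor bit u
  bit-flip g u = bit-vertex _ _

  flip-cong : ∀ g h u → g (base u) ≡ h (base u) → flip g u ≡ flip h u
  flip-cong g h u eq = cong (λ x → vertex (x xor bit u) (base u)) eq

  flip-flip : ∀ g h u → flip g (flip h u) ≡ flip (λ b → g b xor h b) u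
  flip-flip g h u = cong₂ vertex
    (trans (cong₂ _xor_ (cong g (base-flip h u)) (bit-flip h u)) (sym (xor-assoc (g (base u)) (h (base u)) (bit u))))
    (base-flip h u)

  flip-involutive : ∀ g u → flip g (flip g u) ≡ u
  flip-involutive g u = begin
    flip g (flip g u)              ≡⟨ flip-flip g g u ⟩
    flip (λ b → g b xor g b) u     ≡⟨ cong (λ x → vertex (x xor bit u) (base u)) (xor-same (g (base u))) ⟩
    vertex (bit u) (base u)        ≡⟨ vertex-bit-base u ⟩
    u                              ∎
    where open ≡-Reasoning

  flip-injectiveˡ : ∀ g h u → flip g u ≡ flip h u → g (base u) ≡ h (base u)
  flip-injectiveˡ g h u eq = begin
    g (base u)                       ≡⟨ xor-cancelˡ (bit u) _ ⟨
    bit u xor (bit u xor g (base u)) ≡⟨ cong (bit u xor_) bits ⟩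
    bit u xor (bit u xor h (base u)) ≡⟨ xor-cancelˡ (bit u) _ ⟩
    h (base u)                       ∎
    where
    open ≡-Reasoning
    bits : bit u xor g (base u) ≡ bit u xor h (base u)
    bits = begin
      bit u xor g (base u) ≡⟨ xor-comm (bit u) _ ⟩
      g (base u) xor bit u ≡⟨ bit-flip g u ⟨
      bit (flip g u)       ≡⟨ cong bit eq ⟩
      bit (flip h u)       ≡⟨ bit-flip h u ⟩
      h (base u) xor bit u ≡⟨ xor-comm _ (bit u) ⟩
      bit u xor h (base u) ∎

  bases : ∀ {k} → Vec (Fin (2 * n)) k → Vec (Fin n) k
  bases = map base

  flips : ∀ {k} → (Fin n → Bool) → Vec (Fin (2 * n)) k → Vec (Fin (2 * n)) k
  flips g = map (flip g)

  bases-flips : ∀ {k} g (v : Vec _ k) → bases (flips g v) ≡ bases v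
  bases-flips g v = trans (sym (map-∘ base (flip g) v)) (map-cong (base-flip g) v)

  flips-involutive : ∀ {k} g (v : Vec _ k) → flips g (flips g v) ≡ v
  flips-involutive g v = trans (sym (map-∘ _ _ v)) (trans (map-cong (flip-involutive g) v) (map-id v))

  flips-flips : ∀ {k} g h (v : Vec _ k) → flips g (flips h v) ≡ flips (λ b → g b xor h b) v
  flips-flips g h v = trans (sym (map-∘ _ _ v)) (map-cong (flip-flip g h) v)

  flips-cong : ∀ {k} g h (v : Vec _ k) →
    (∀ i → g (lookup (bases v) i) ≡ h (lookup (bases v) i)) → flips g v ≡ flips h v
  flips-cong g h []      eq = refl
  flips-cong g h (u ∷ v) eq = cong₂ _∷_ (flip-cong g h u (eq zero)) (flips-cong g h v (eq ∘ fsuc))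

  flips-injectiveˡ : ∀ {k} g h (v : Vec _ k) → flips g v ≡ flips h v →
    ∀ i → g (lookup (bases v) i) ≡ h (lookup (bases v) i)
  flips-injectiveˡ g h v eq i = subst (λ b → g b ≡ h b) (sym (lookup-map i base v))
    (flip-injectiveˡ g h (lookup v i) (begin
      flip g (lookup v i)    ≡⟨ lookup-map i (flip g) v ⟨
      lookup (flips g v) i   ≡⟨ cong (λ w → lookup w i) eq ⟩
      lookup (flips h v) i   ≡⟨ lookup-map i (flip h) v ⟩
      flip h (lookup v i)    ∎))
    where open ≡-Reasoning

  -- The flip that brings a tuple to the normal form of its orbit, in which the first
  -- vertex over every point has bit 0.
  firstBit : ∀ {k} → Vec (Fin (2 * n)) k → Fin n → Bool
  firstBit []      b = false
  firstBit (u ∷ v) b = if does (base u ≟ b) then bit u else firstBit v b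

  -- The point must be a base of `v`: elsewhere `firstBit` is the default `false` before and after
  -- the flip, whatever `g` does.
  firstBit-flips : ∀ {k} g (v : Vec _ k) i → let b = lookup (bases v) i in
    firstBit (flips g v) b ≡ g b xor firstBit v b
  firstBit-flips g v i = go v i refl
    where
    go : ∀ {k} (v : Vec _ k) i {b} → lookup (bases v) i ≡ b →
      firstBit (flips g v) b ≡ g b xor firstBit v b
    go (u ∷ v) i {b} eq rewrite base-flip g u with base u ≟ b
    go (u ∷ v) i        eq | yes refl  = bit-flip g u
    go (u ∷ v) zero     eq | no  u≢b   = contradiction eq u≢b
    go (u ∷ v) (fsuc i) eq | no  _     = go v i eq

-- Block systems: S r j is the j-th point of block r.
module BlockColoring {ℓ p n : ℕ} (S : Fin ℓ → Fin (suc p) → Fin n)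
  (S-position : ∀ {r s i j} → S r i ≡ S s j → i ≡ j)
  (S-distance : ∀ {r s} i → (∀ j → j ≢ i → S r j ≡ S s j) → r ≡ s) where

  open Fibres n

  -- Tuples whose entries cover a block

  k : ℕ
  k = suc p

  record Covers (r : Fin ℓ) (a : Vec (Fin n) k) : Set where
    constructor covering
    field at : ∀ j → ∃ λ l → lookup a l ≡ S r j
  open Covers

  Covers-mono : ∀ {r a a′} → (∀ l → ∃ λ l′ → lookup a′ l′ ≡ lookup a l) → Covers r a → Covers r a′
  Covers-mono a⊆a′ cov = covering λ j →
    let l , eq = at cov j ; l′ , eq′ = a⊆a′ l in l′ , trans eq′ eq

  -- By `S-position` the points of a block are distinct, so they sit at distinct places, and an
  -- injection of `Fin k` into itself hits every place.
  covers-surjective : ∀ {r a} → (cov : Covers r a) → ∀ l → ∃ λ j → proj₁ (at cov j) ≡ l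
  covers-surjective {a = a} cov = injective⇒surjective λ {i} {j} eq →
    S-position (trans (sym (proj₂ (at cov i))) (trans (cong (lookup a) eq) (proj₂ (at cov j))))

  covered : ∀ {r a} → Covers r a → ∀ l → ∃ λ j → lookup a l ≡ S r j
  covered {a = a} cov l with j , refl ← covers-surjective cov l = j , proj₂ (at cov j)

  covers⇒injective : ∀ {r a} → Covers r a → Injective _≡_ _≡_ (lookup a)
  covers⇒injective {a = a} cov {l} {l′} eq
    with j , refl ← covers-surjective cov l | j′ , refl ← covers-surjective cov l′ =
    cong (proj₁ ∘ at cov) (S-position (trans (sym (proj₂ (at cov j))) (trans eq (proj₂ (at cov j′)))))

  -- An entry away from `i` survives the update, so it is a point of both blocks, and `S-position`
  -- puts it at the same position in both.
  covers-agree : ∀ {r s a i b} (cov : Covers r a) → Covers s (a [ i ]≔ b) →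
    ∀ j → proj₁ (at cov j) ≢ i → S r j ≡ S s j
  covers-agree {r} {s} {a} {i} {b} cov cov′ j ρj≢i = trans Srj≡ (cong (S s) (sym (S-position Srj≡)))
    where
    Srj≡ : S r j ≡ S s (proj₁ (covered cov′ (proj₁ (at cov j))))
    Srj≡ = trans (sym (proj₂ (at cov j))) (trans (sym (lookup∘update′ ρj≢i a b))
      (proj₂ (covered cov′ (proj₁ (at cov j)))))

  -- The blocks agree except possibly at the position that `a` places at `i`, so `S-distance` makes
  -- them equal. Their common point there must occur in the updated tuple; away from `i` it would be
  -- a repeated entry of `a`, so it is `b`.
  covers-unique : ∀ {r s} a i b → Covers r a → Covers s (a [ i ]≔ b) → b ≡ lookup a i
  covers-unique {r} {s} a i b cov cov′
    with j₀ , refl ← covers-surjective cov i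
    with refl ← S-distance {r} {s} j₀ (λ j j≢j₀ → covers-agree cov cov′ j λ eq →
      j≢j₀ (S-position (trans (sym (proj₂ (at cov j))) (trans (cong (lookup a) eq) (proj₂ (at cov j₀))))))
    with proj₁ (at cov′ j₀) ≟ proj₁ (at cov j₀) | proj₂ (at cov′ j₀)
  ... | yes eq | eq′ = begin
    b                                      ≡⟨ lookup∘update i a b ⟨
    lookup (a [ i ]≔ b) i                  ≡⟨ cong (lookup (a [ i ]≔ b)) eq ⟨
    lookup (a [ i ]≔ b) (proj₁ (at cov′ j₀))  ≡⟨ eq′ ⟩
    S r j₀                                 ≡⟨ proj₂ (at cov j₀) ⟨
    lookup a i                             ∎
    where open ≡-Reasoning
  ... | no neq | eq′ = contradiction (covers⇒injective cov
    (trans (sym (lookup∘update′ neq a b)) (trans eq′ (sym (proj₂ (at cov j₀)))))) neq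

  covers-block : ∀ {r s} → Covers r (tabulate (S s)) → r ≡ s
  covers-block {r} {s} cov = S-distance zero λ j _ →
    let l , eq = at cov j ; eq′ = trans (sym (lookup∘tabulate (S s) l)) eq
    in trans (sym eq′) (cong (S s) (S-position eq′))

  -- The support of a is one of the first t blocks; by counting, covering suffices.
  Block : ℕ → Vec (Fin n) k → Set
  Block t a = ∃ λ r → toℕ r < t × Covers r a

  abstract

    block? : ∀ t a → Dec (Block t a)
    block? t a = any? λ r → (toℕ r <? t) ×-dec map′ covering at (all? λ j → any? λ l → lookup a l ≟ S r j)

  -- Extending a local flip by one point

  EvenOn : ℕ → (Fin n → Bool) → Vec (Fin n) k → Set
  EvenOn t g a = Block t a → parity g a ≡ false

  -- Up to order, a[b/j] is a[b/i] with its j-th entry replaced by aᵢ.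
  neighbour-blocks : ∀ {t} a b i j → Block t (a [ i ]≔ b) → Block t (a [ j ]≔ b) →
    lookup a i ≡ lookup a j
  neighbour-blocks a b i j (r , _ , covᵢ) (s , _ , covⱼ) with i ≟ j
  ... | yes refl = refl
  ... | no  i≢j  = trans (covers-unique (a [ i ]≔ b) j c covᵢ (Covers-mono swapped covⱼ)) (lookup∘update′ (i≢j ∘ sym) a b)
    where
    c = lookup a i
    swapped : ∀ l → ∃ λ l′ → lookup ((a [ i ]≔ b) [ j ]≔ c) l′ ≡ lookup (a [ j ]≔ b) l
    swapped l with l ≟ j | l ≟ i
    ... | yes refl | _ = i , trans (lookup∘update′ i≢j (a [ i ]≔ b) c)
                               (trans (lookup∘update i a b) (sym (lookup∘update j a b)))
    ... | no l≢j | yes refl = j , trans (lookup∘update j (a [ i ]≔ b) c) (sym (lookup∘update′ l≢j a b))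
    ... | no l≢j | no l≢i = l , trans (lookup∘update′ l≢j (a [ i ]≔ b) c)
                               (trans (lookup∘update′ l≢i a b) (sym (lookup∘update′ l≢j a b)))

  -- Here `x` is the future value of the extended flip at `b`. The last condition is evenness on
  -- `a [ i ]≔ b` as expanded by `parity-update`, so `x` can be chosen before the extended flip
  -- exists.
  extend-at : ∀ t a g → EvenOn t g a → ∀ b → ∃ λ x →
    (∀ l → lookup a l ≡ b → x ≡ g b) ×
    (∀ i → Block t (a [ i ]≔ b) → (parity g a xor g (lookup a i)) xor x ≡ false)
  extend-at t a g even b with any? (λ l → lookup a l ≟ b)
  ... | yes (l , al≡b) = g b , (λ _ _ → refl) , closed
    where
    closed : ∀ i → Block t (a [ i ]≔ b) → (parity g a xor g (lookup a i)) xor g b ≡ false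
    -- If `b` already stands at a place other than `i`, the update repeats it and cannot be a block;
    -- if it stands at `i`, the update changes nothing.
    closed i bl@(_ , _ , cov) with l ≟ i
    ... | no l≢i = contradiction
      (covers⇒injective cov (trans (lookup∘update′ l≢i a b) (trans al≡b (sym (lookup∘update i a b))))) l≢i
    ... | yes refl = trans (sym (parity-update g a i b))
      (trans (cong (parity g) a≡) (even (subst (Block t) a≡ bl)))
      where
      a≡ : a [ i ]≔ b ≡ a
      a≡ = trans (cong (a [ i ]≔_) (sym al≡b)) ([]≔-lookup a i)
  ... | no b∉a with any? (λ j → block? t (a [ j ]≔ b))
  -- One block neighbour dictates `x`. Any other replaces an equal entry and so imposes the same
  -- equation.
  ...   | yes (j , blⱼ) = parity g a xor g (lookup a j) , (λ l eq → contradiction (l , eq) b∉a) ,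
          λ i blᵢ → trans (cong (λ c → (parity g a xor g c) xor _) (neighbour-blocks a b i j blᵢ blⱼ)) (xor-same (parity g a xor g (lookup a j)))
  -- No neighbour is a block, so the value is arbitrary.
  ...   | no none = false , (λ l eq → contradiction (l , eq) b∉a) ,
          λ i bl → contradiction (i , bl) none

  -- Each neighbour involves a single added point, so the values at different `b` can be chosen
  -- independently.
  extend : ∀ t a g → EvenOn t g a → ∃ λ g⁺ →
    (∀ l → g (lookup a l) ≡ g⁺ (lookup a l)) × (∀ i b → EvenOn t g⁺ (a [ i ]≔ b))
  extend t a g even = g⁺ , agree , λ i b bl → begin
    parity g⁺ (a [ i ]≔ b)
      ≡⟨ parity-update g⁺ a i b ⟩
    (parity g⁺ a xor g⁺ (lookup a i)) xor g⁺ b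
      ≡⟨ cong₂ (λ x y → (x xor y) xor g⁺ b) (parity-cong a agree) (agree i) ⟨
    (parity g a xor g (lookup a i)) xor g⁺ b
      ≡⟨ proj₂ (proj₂ (extend-at t a g even b)) i bl ⟩
    false ∎
    where
    open ≡-Reasoning
    g⁺ : Fin n → Bool
    g⁺ b = proj₁ (extend-at t a g even b)
    agree : ∀ l → g (lookup a l) ≡ g⁺ (lookup a l)
    agree l = sym (proj₁ (proj₂ (extend-at t a g even (lookup a l))) l refl)

  -- Local orbits and the colourings

  V : Set
  V = Fin (2 * n)

  -- Evenness is required on the support of `v` alone, not on all blocks; `extend` later carries
  -- such a local flip to the neighbours.
  _~[_]_ : Vec V k → ℕ → Vec V k → Set
  v ~[ t ] w = ∃ λ g → flips g v ≡ w × EvenOn t g (bases v)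

  Color : Set
  Color = Vec V k × Bool

  blockParity : ∀ t (a : Vec (Fin n) k) → Bool → Bool
  blockParity t a x = if does (block? t a) then x else false

  blockParity-block : ∀ {t a} → Block t a → ∀ x → blockParity t a x ≡ x
  blockParity-block {t} {a} bl x = cong (if_then x else false) (dec-true (block? t a) bl)

  blockParity-cong : ∀ {t a x y} → (Block t a → x ≡ y) → blockParity t a x ≡ blockParity t a y
  blockParity-cong {t} {a} eq with block? t a
  ... | yes bl = eq bl
  ... | no  _  = refl

  -- A complete invariant of the orbit: the normal form under all flips and, over a block, the
  -- parity of the flip leading to it.
  color : ℕ → Coloring (2 * n) k Color
  color t v = flips (firstBit v) v , blockParity t (bases v) (parity (firstBit v) (bases v))

  -- Normalise `v`, then undo the normalisation of `w`. Over a block the equal bits make the two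
  -- parities cancel.
  color⇒~ : ∀ {t v w} → color t v ≡ color t w → v ~[ t ] w
  color⇒~ {t} {v} {w} eq with normal , parities ← ,-injective eq =
    (λ b → firstBit w b xor firstBit v b) , moves , even
    where
    moves : flips (λ b → firstBit w b xor firstBit v b) v ≡ w
    moves = trans (sym (flips-flips (firstBit w) (firstBit v) v))
      (trans (cong (flips (firstBit w)) normal) (flips-involutive (firstBit w) w))
    same-bases : bases w ≡ bases v
    same-bases = trans (sym (bases-flips (firstBit w) w))
      (trans (cong bases (sym normal)) (bases-flips (firstBit v) v))
    even : EvenOn t (λ b → firstBit w b xor firstBit v b) (bases v)
    even bl = trans (parity-xor (firstBit w) (firstBit v) (bases v)) (trans (cong (_xor pv) pw≡pv) (xor-same pv))
      where
      open ≡-Reasoning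
      pv = parity (firstBit v) (bases v)
      pw≡pv : parity (firstBit w) (bases v) ≡ parity (firstBit v) (bases v)
      pw≡pv = begin
        parity (firstBit w) (bases v) ≡⟨ blockParity-block bl _ ⟨
        blockParity t (bases v) (parity (firstBit w) (bases v))
          ≡⟨ cong (λ a → blockParity t a (parity (firstBit w) a)) same-bases ⟨
        blockParity t (bases w) (parity (firstBit w) (bases w)) ≡⟨ parities ⟨
        blockParity t (bases v) (parity (firstBit v) (bases v)) ≡⟨ blockParity-block bl _ ⟩
        parity (firstBit v) (bases v) ∎

  -- On the entries, the normalising flip of `flips g v` is that of `v` plus `g`. The normal form is
  -- thus unchanged, and over a block the parity shifts by that of `g`, which is zero.
  ~⇒color : ∀ {t v w} → v ~[ t ] w → color t v ≡ color t w
  ~⇒color {t} {v} (g , refl , even) = sym (cong₂ _,_ normal parities)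
    where
    open ≡-Reasoning
    w = flips g v
    fw : Fin n → Bool
    fw b = g b xor firstBit v b
    fw-correct : ∀ i → firstBit w (lookup (bases v) i) ≡ fw (lookup (bases v) i)
    fw-correct = firstBit-flips g v
    normal : flips (firstBit w) w ≡ flips (firstBit v) v
    normal = begin
      flips (firstBit w) (flips g v)               ≡⟨ flips-flips (firstBit w) g v ⟩
      flips (λ b → firstBit w b xor g b) v         ≡⟨ flips-cong (λ b → firstBit w b xor g b) (firstBit v) v (λ i → begin
        _ ≡⟨ cong (_xor g (lookup (bases v) i)) (fw-correct i) ⟩
        _ ≡⟨ xor-comm (fw (lookup (bases v) i)) _ ⟩
        _ ≡⟨ xor-cancelˡ (g (lookup (bases v) i)) _ ⟩
        _ ∎) ⟩
      flips (firstBit v) v                         ∎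
    parities : blockParity t (bases w) (parity (firstBit w) (bases w))
             ≡ blockParity t (bases v) (parity (firstBit v) (bases v))
    parities = begin
      blockParity t (bases w) (parity (firstBit w) (bases w))
        ≡⟨ cong (λ a → blockParity t a (parity (firstBit w) a)) (bases-flips g v) ⟩
      blockParity t (bases v) (parity (firstBit w) (bases v))
        ≡⟨ blockParity-cong (λ bl → begin
             parity (firstBit w) (bases v)                    ≡⟨ parity-cong (bases v) fw-correct ⟩
             parity fw (bases v)                              ≡⟨ parity-xor g (firstBit v) (bases v) ⟩
             parity g (bases v) xor parity (firstBit v) (bases v) ≡⟨ cong (_xor _) (even bl) ⟩
             parity (firstBit v) (bases v)                    ∎) ⟩
      blockParity t (bases v) (parity (firstBit v) (bases v)) ∎

  -- Shufflability, compatibility with equality and stability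

  -- The same flip serves. If the shuffled support is a block, its entries are distinct, so `π` is
  -- injective and merely permutes the terms of the parity, and the original support covers the same
  -- block.
  shufflable : ∀ t → Shufflable (color t)
  shufflable t π v w eq with g , refl , even ← color⇒~ {t} {v} {w} eq =
    ~⇒color {t} (g , map-reindex (flip g) v π , even′)
    where
    a = bases v
    aπ = tabulate (lookup a ∘ π)
    aπ-lookup : ∀ i → lookup aπ i ≡ lookup a (π i)
    aπ-lookup = lookup∘tabulate (lookup a ∘ π)
    even-aπ : EvenOn t g aπ
    even-aπ (r , r<t , cov) = trans
      (parity-permute g a λ {i} {j} πi≡πj → covers⇒injective cov
        (trans (aπ-lookup i) (trans (cong (lookup a) πi≡πj) (sym (aπ-lookup j)))))
      (even (r , r<t , Covers-mono (λ l → π l , sym (aπ-lookup l)) cov))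
    even′ : EvenOn t g (bases (tabulate (lookup v ∘ π)))
    even′ = subst (EvenOn t g) (sym (map-reindex base v π)) even-aπ

  compatibleEq : ∀ t → CompatibleEq (color t)
  compatibleEq t v w eq i j with g , refl , _ ← color⇒~ {t} {v} {w} eq
    rewrite lookup-map i (flip g) v | lookup-map j (flip g) v =
    cong (flip g) ,
    λ e → trans (sym (flip-involutive g _)) (trans (cong (flip g) e) (flip-involutive g _))

  -- The extended flip is an involution of the vertices, and the pairing of `u` with `flip g⁺ u`
  -- matches the colours at all `k` places simultaneously.
  stable : ∀ t → Stable (color t)
  stable t v w = (λ eq → eq , neighbours eq) , proj₁
    where
    neighbours : color t v ≡ color t w → nbrColors (color t) v ↭ nbrColors (color t) w
    neighbours eq with g , refl , even ← color⇒~ {t} {v} {w} eq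
      with g⁺ , agree , even⁺ ← extend t (bases v) g even =
      subst (_↭ nbrColors (color t) w)
        (trans (sym (L.map-∘ (allV (2 * n)))) (L.map-cong (λ u → tabulate-cong (λ i → sym (same u i))) (allV (2 * n))))
        (↭-map⁺ _ (map-involution-↭ (flip g⁺) (flip-involutive g⁺)))
      where
      same : ∀ u i → color t (v [ i ]≔ u) ≡ color t (w [ i ]≔ flip g⁺ u)
      same u i = ~⇒color {t}
        ( g⁺
        , trans (map-[]≔ (flip g⁺) v i) (cong (_[ i ]≔ flip g⁺ u) (sym (flips-cong g g⁺ v agree)))
        , subst (EvenOn t g⁺) (sym (map-[]≔ base v i)) (even⁺ i (base u)))

  -- Strict refinement along the chain

  color-mono : ∀ {t t′} → t ≤ t′ → color t′ ⪯ color t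
  color-mono t≤t′ v w eq with g , moves , even ← color⇒~ {v = v} {w} eq =
    ~⇒color (g , moves , λ (r , r<t , cov) → even (r , ≤-trans r<t t≤t′ , cov))

  -- Flipping one fibre over block `r` is allowed at stage `toℕ r`. Any flip with the same effect on
  -- the tuple agrees with it on the entries, hence is odd and forbidden one stage later.
  color-strict : ∀ (r : Fin ℓ) → ¬ (color (toℕ r) ⪯ color (suc (toℕ r)))
  color-strict r finer = contradiction (trans (sym odd) (trans (parity-cong a same) even)) λ ()
    where
    a = tabulate (S r)
    v = map (vertex false) a
    h : Fin n → Bool
    h b = does (b ≟ lookup a zero)
    bases-v : bases v ≡ a
    bases-v = trans (sym (map-∘ base (vertex false) a)) (trans (map-cong (base-vertex false) a) (map-id a))
    cov : Covers r a
    cov = covering λ j → j , lookup∘tabulate (S r) j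
    odd : parity h a ≡ true
    odd = parity-indicator a (covers⇒injective cov)
    -- The only block that `a` covers is `r` itself, and its index is not below `toℕ r`.
    not-yet : EvenOn (toℕ r) h (bases v)
    not-yet (s , s<r , cov′) = contradiction s<r
      (<-irrefl (cong toℕ (covers-block (subst (Covers s) bases-v cov′))))
    related : v ~[ suc (toℕ r) ] flips h v
    related = color⇒~ (finer v (flips h v) (~⇒color (h , refl , not-yet)))
    g = proj₁ related
    same : ∀ i → h (lookup a i) ≡ g (lookup a i)
    same = subst (λ a → ∀ i → h (lookup a i) ≡ g (lookup a i)) bases-v
      (flips-injectiveˡ h g v (sym (proj₁ (proj₂ related))))
    even : parity g a ≡ false
    even = subst (EvenOn (suc (toℕ r)) g) bases-v (proj₂ (proj₂ related)) (r , ≤-refl , cov)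

  color-≺ : ∀ (r : Fin ℓ) → color (toℕ (fsuc r)) ≺ color (toℕ (inject₁ r))
  color-≺ r rewrite toℕ-inject₁ r =
    color-mono (<⇒≤ (n<1+n (toℕ r))) , λ (_ , finer) → color-strict r finer

-- The check-digit code

-- Modulo `m = suc m′` the number `c * m′` represents minus `c`, so adding it undoes the shift.
+-cancelʳ-% : ∀ {m a b} .{{_ : NonZero m}} c → a < m → b < m → (a + c) % m ≡ (b + c) % m → a ≡ b
+-cancelʳ-% {m@(suc m′)} {a} {b} c a<m b<m eq = begin
  a                                      ≡⟨ undo a<m ⟨
  ((a + c) % m + (c * m′) % m) % m       ≡⟨ cong (λ x → (x + (c * m′) % m) % m) eq ⟩
  ((b + c) % m + (c * m′) % m) % m       ≡⟨ undo b<m ⟩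
  b                                      ∎
  where
  open ≡-Reasoning
  undo : ∀ {x} → x < m → ((x + c) % m + (c * m′) % m) % m ≡ x
  undo {x} x<m = begin
    ((x + c) % m + (c * m′) % m) % m ≡⟨ %-distribˡ-+ (x + c) (c * m′) m ⟨
    (x + c + c * m′) % m             ≡⟨ cong (_% m) (+-assoc x c (c * m′)) ⟩
    (x + (c + c * m′)) % m           ≡⟨ cong (λ y → (x + y) % m) (*-suc c m′) ⟨
    (x + c * m) % m                  ≡⟨ [m+kn]%n≡m%n x c m ⟩
    x % m                            ≡⟨ m<n⇒m%n≡m x<m ⟩
    x                                ∎

module CheckDigitCode (m q : ℕ) .{{_ : NonZero m}} where

  check : (Fin q → Fin m) → Fin m
  check d = ∑ (toℕ ∘ d) mod m

  word : Fin (m ^ q) → Fin (suc q) → Fin m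
  word r zero     = check (finToFun r)
  word r (fsuc j) = finToFun r j

  check-injective : ∀ (d e : Fin q → Fin m) i → (∀ j → j ≢ i → d j ≡ e j) → check d ≡ check e → d i ≡ e i
  check-injective d e i agree eq = go d e i agree (begin
    ∑ (toℕ ∘ d) % m ≡⟨ toℕ-fromℕ< _ ⟨
    toℕ (check d)   ≡⟨ cong toℕ eq ⟩
    toℕ (check e)   ≡⟨ toℕ-fromℕ< _ ⟩
    ∑ (toℕ ∘ e) % m ∎)
    where
    open ≡-Reasoning
    -- Quantifying over `q` afresh lets it be matched as a successor, as splitting digit `i` off the
    -- sum requires.
    go : ∀ {q} (d e : Fin q → Fin m) i → (∀ j → j ≢ i → d j ≡ e j) →
      ∑ (toℕ ∘ d) % m ≡ ∑ (toℕ ∘ e) % m → d i ≡ e i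
    go {suc q} d e i agree eq = toℕ-injective (+-cancelʳ-% rest (toℕ<n (d i)) (toℕ<n (e i)) (begin
      (toℕ (d i) + rest) % m                             ≡⟨ cong (_% m) (∑-remove {i = i} (toℕ ∘ d)) ⟨
      ∑ (toℕ ∘ d) % m                                    ≡⟨ eq ⟩
      ∑ (toℕ ∘ e) % m                                    ≡⟨ cong (_% m) (∑-remove {i = i} (toℕ ∘ e)) ⟩
      (toℕ (e i) + ∑ (λ j → toℕ (e (punchIn i j)))) % m
        ≡⟨ cong (λ x → (toℕ (e i) + x) % m) (∑-cong (λ j → cong toℕ (agree _ (punchInᵢ≢i i j)))) ⟨
      (toℕ (e i) + rest) % m                             ∎))
      where rest = ∑ (λ j → toℕ (d (punchIn i j)))

  -- If the check digit is withheld, all free digits are known; if a free digit is withheld, the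
  -- check digit recovers it.
  word-distance : ∀ {r s} i → (∀ j → j ≢ i → word r j ≡ word s j) → r ≡ s
  word-distance zero     agree = finToFun-injective {q} {m} λ j → agree (fsuc j) λ ()
  word-distance {r} {s} (fsuc i) agree = finToFun-injective {q} {m} digits
    where
    others : ∀ j → j ≢ i → finToFun {m} {q} r j ≡ finToFun s j
    others j j≢i = agree (fsuc j) λ { refl → j≢i refl }
    digits : finToFun {m} {q} r ≗ finToFun s
    digits j with j ≟ i
    ... | no  j≢i  = others j j≢i
    ... | yes refl = check-injective (finToFun r) (finToFun s) i others (agree zero λ ())

  module _ {n : ℕ} (fits : suc q * m ≤ n) where

    -- Each position draws from its own class of `m` points. The classes are disjoint, so a point
    -- reveals its position.
    block : Fin (m ^ q) → Fin (suc q) → Fin n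
    block r j = inject≤ (combine j (word r j)) fits

    block-injective : ∀ r s i j → block r i ≡ block s j → i ≡ j × word r i ≡ word s j
    block-injective r s i j eq = combine-injective i (word r i) j (word s j) (inject≤-injective fits fits _ _ eq)

    block-distance : ∀ {r s} i → (∀ j → j ≢ i → block r j ≡ block s j) → r ≡ s
    block-distance i agree = word-distance i λ j j≢i → proj₂ (block-injective _ _ j j (agree j j≢i))

-- The length of the chain

^-distribʳ-* : ∀ q m n → (m * n) ^ q ≡ m ^ q * n ^ q
^-distribʳ-* 0       m n = refl
^-distribʳ-* (suc q) m n =
  trans (cong (m * n *_) (^-distribʳ-* q m n)) ([m*n]*[o*p]≡[m*o]*[n*p] m n (m ^ q) (n ^ q))

-- The quotient is at least one, so the remainder is at most `n / k * k`: rounding down costs at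
-- most a factor of two.
n≤[n/k]*2k : ∀ n k .{{_ : NonZero k}} → k ≤ n → n ≤ n / k * (2 * k)
n≤[n/k]*2k n k k≤n = begin
  n                            ≡⟨ m≡m%n+[m/n]*n n k ⟩
  n % k + n / k * k            ≤⟨ +-monoˡ-≤ _ (<⇒≤ (m%n<n n k)) ⟩
  k + n / k * k                ≡⟨ cong (_+ n / k * k) (*-identityˡ k) ⟨
  1 * k + n / k * k            ≤⟨ +-monoˡ-≤ _ (*-monoˡ-≤ k (m≥n⇒m/n>0 k≤n)) ⟩
  n / k * k + n / k * k        ≡⟨ *-distribˡ-+ (n / k) k k ⟨
  n / k * (k + k)              ≡⟨ cong (λ x → n / k * (k + x)) (+-identityʳ k) ⟨
  n / k * (2 * k)              ∎
  where open ≤-Reasoning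

theorem4p1 : (k n : ℕ) → 2 ≤ k → 2 * (k * k) ≤ n →
    Σ ℕ λ ℓ → Σ Set λ C → Σ (Fin (suc ℓ) → Coloring (2 * n) k C) λ χ →
    (n ^ (k ∸ 1) ≤ ℓ * (2 * k) ^ (k ∸ 1))
    × (∀ t → Shufflable (χ t) × CompatibleEq (χ t))
    × (∀ t → Stable (χ t))
    × (∀ (t : Fin ℓ) → χ (fsuc t) ≺ χ (inject₁ t))
theorem4p1 k@(suc q) n _ 2k²≤n =
  -- One step for each choice of `q` free digits, starting from the colouring in which no block is
  -- constrained.
  m ^ q , Color , color ∘ toℕ , long , (λ t → shufflable (toℕ t) , compatibleEq (toℕ t)) , stable ∘ toℕ , color-≺
  where
  k≤n : k ≤ n
  k≤n = ≤-trans (m≤m*n k k) (≤-trans (m≤n*m (k * k) 2) 2k²≤n)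
  m = n / k
  instance
    m≢0 : NonZero m
    m≢0 = >-nonZero (m≥n⇒m/n>0 k≤n)
  open CheckDigitCode m q
  fits : k * m ≤ n
  fits = ≤-trans (≤-reflexive (*-comm k m)) (m/n*n≤m n k)
  open BlockColoring (block fits) (λ {r} {s} {i} {j} eq → proj₁ (block-injective fits r s i j eq)) (block-distance fits) hiding (k)
  long : n ^ q ≤ m ^ q * (2 * k) ^ q
  long = ≤-trans (^-monoˡ-≤ q (n≤[n/k]*2k n k k≤n)) (≤-reflexive (^-distribʳ-* q m (2 * k)))
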